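{- Let $p\ge5$ be an odd prime and put $$g_p:=\left\lfloor \frac{p-1}{4}\right\rfloor.$$ The set of nonzero quadratic residues $$\mathcal{Q}_p=\{x^2 \bmod p : x\not\equiv 0\pmod p\}$$ forms a modular $g_p$-Golomb ruler modulo $p$, with $(p-1)/2$ marks.
   Context: A set $\mathcal{A}$ of residues modulo $N$ is a modular $g$-Golomb ruler modulo $N$ if every nonzero residue modulo $N$ occurs at most $g$ times as a difference $a-a' \pmod N$ with $(a,a')$ an ordered pair of distinct elements of $\mathcal{A}$; its elements are called marks. -}

module Defs where

open import Data.Fin.Base using (Fin; toℕ)
open import Data.Fin.Properties using (_≟_; any?)
open import Data.Fin.Subset using (Subset; _∈_)
open import Data.Fin.Subset.Properties using (_∈?_)
open import Data.Integer.Base using (_⊖_)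
open import Data.Integer.DivMod using (_%ℕ_)
open import Data.List.Base using (length; filter; allFin; cartesianProduct)
open import Data.Nat.Base using (ℕ; NonZero; _≤_; _∸_; _^_; _/_)
open import Data.Nat.DivMod using (_mod_)
open import Data.Nat.Divisibility using (_∤_; _∣?_)
import Data.Nat.Properties as ℕ
open import Data.Product.Base using (_×_; _,_; ∃)
open import Data.Vec.Base using (tabulate)
open import Relation.Binary.PropositionalEquality.Core using (_≡_; _≢_)
open import Relation.Nullary.Decidable.Core using (Dec; does; ¬?; _×-dec_)

-- Residues modulo N are represented by Fin N. Here _⊖_ is the difference of
-- two naturals as an integer, and _%ℕ_ is the remainder in {0, …, N ∸ 1}.
module _ (N : ℕ) .{{_ : NonZero N}} where

  HasDifference : Subset N → Fin N → Fin N × Fin N → Set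
  HasDifference A r (a , a′) =
    a ∈ A × a′ ∈ A × a ≢ a′ × (toℕ a ⊖ toℕ a′) %ℕ N ≡ toℕ r

  hasDifference? : ∀ A r aa′ → Dec (HasDifference A r aa′)
  hasDifference? A r (a , a′) =
    a ∈? A ×-dec a′ ∈? A ×-dec ¬? (a ≟ a′) ×-dec
    (toℕ a ⊖ toℕ a′) %ℕ N ℕ.≟ toℕ r

  occurrences : Subset N → Fin N → ℕ
  occurrences A r =
    length (filter (hasDifference? A r) (cartesianProduct (allFin N) (allFin N)))

  IsModularGolombRuler : ℕ → Subset N → Set
  IsModularGolombRuler g A = ∀ (r : Fin N) → toℕ r ≢ 0 → occurrences A r ≤ g

module _ (p : ℕ) .{{_ : NonZero p}} where

  -- Since x² mod p depends only on the class of x, it suffices to let x range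
  -- over Fin p rather than over all integers.
  IsNonzeroSquare : Fin p → Set
  IsNonzeroSquare y = ∃ λ (x : Fin p) → p ∤ toℕ x × (toℕ x ^ 2) mod p ≡ y

  isNonzeroSquare? : ∀ y → Dec (IsNonzeroSquare y)
  isNonzeroSquare? y =
    any? λ x → ¬? (p ∣? toℕ x) ×-dec (toℕ x ^ 2) mod p ≟ y

  𝒬 : Subset p
  𝒬 = tabulate λ y → does (isNonzeroSquare? y)

-- _/_ on ℕ rounds down.
g[_] : ℕ → ℕ
g[ p ] = (p ∸ 1) / 4

{-# OPTIONS --safe #-}

-- If a − a′ = r with a = x² and a′ = y² nonzero squares, then the four numbers
-- u = ±x ± y all satisfy u · v = r with v = ±x ∓ y. Since r ≠ 0, u is nonzero
-- and determines v = r / u, hence ±x = (u + v) / 2 and ±y = (u − v) / 2. So the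
-- representations of r, taken four times, inject into the p − 1 nonzero
-- residues. In the same way two roots per square give 2 · ∣𝒬∣ ≤ p − 1, while
-- 1², …, ((p − 1) / 2)² are pairwise incongruent.
module Submission where

open import Defs
open import Data.Bool.Base using (true)
open import Data.Fin.Base using (Fin; zero; suc; toℕ; fromℕ<; combine; remQuot; punchOut)
open import Data.Fin.Properties
  using (injective⇒≤; punchOut-injective; toℕ-fromℕ<; toℕ-injective; toℕ<n;
         combine-remQuot; suc-injective)
open import Data.Fin.Subset using (Subset; inside; outside; _∈_; ∣_∣)
open import Data.Integer.Base as ℤ using (ℤ; +_; 0ℤ; _+_; _-_; _*_; -_)
import Data.Integer.Properties as ℤ
open import Data.Integer.Divisibility.Signed as ℤ∣
  using (divides; ∣⇒∣ᵤ; ∣ᵤ⇒∣; ∣m∣n⇒∣m+n; ∣m∣n⇒∣m-n; ∣m⇒∣-m; ∣m⇒∣m*n)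
open import Data.Integer.DivMod using (_%ℕ_; _/ℕ_; n%ℕd<d; a≡a%ℕn+[a/ℕn]*n)
open import Data.Integer.Tactic.RingSolver using (solve-∀)
open import Data.List.Base as List using (List; length; filter; allFin; cartesianProduct)
open import Data.List.Membership.Propositional.Properties using (∈-lookup)
import Data.List.Relation.Unary.All as All
open import Data.List.Relation.Unary.All.Properties using (all-filter)
open import Data.List.Relation.Unary.AllPairs using (_∷_)
open import Data.List.Relation.Unary.Unique.Propositional using (Unique)
open import Data.List.Relation.Unary.Unique.Propositional.Properties
  using (filter⁺; cartesianProduct⁺; allFin⁺)
open import Data.Nat.Base as ℕ using (ℕ; NonZero; _≤_; _<_; _∸_; _/_; _^_)
open import Data.Nat.Divisibility as ℕ∣ using (_∤_)
open import Data.Nat.DivMod using (_mod_; m*n/n≡m; /-monoˡ-≤; m/n*n≤m; m/n/o≡m/[n*o])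
open import Data.Nat.Primality using (Prime; euclidsLemma)
import Data.Nat.Properties as ℕ
open import Data.Product.Base using (_×_; _,_; ∃; proj₁; proj₂; uncurry; map₁; assocʳ′; assocˡ′)
open import Data.Sum.Base using (_⊎_; inj₁; inj₂; [_,_]′)
open import Data.Vec.Base using (_∷_; here; there)
open import Data.Vec.Properties using ([]=⇒lookup; lookup⇒[]=; lookup∘tabulate)
open import Function.Base using (id; _∘_)
open import Function.Definitions using (Injective)
open import Relation.Binary.PropositionalEquality
  using (_≡_; _≢_; refl; sym; trans; cong; cong₂; subst; subst₂; module ≡-Reasoning)
open import Relation.Nullary using (¬_; Dec; does; proof; contradiction)
open import Relation.Nullary.Decidable using (dec-true)
open import Relation.Nullary.Reflects using (Reflects; invert)

-- Counting by injections between finite types.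

injective-avoiding⇒≤ : ∀ {m n} {f : Fin m → Fin n} (z : Fin n) →
  Injective _≡_ _≡_ f → (∀ i → z ≢ f i) → m ≤ n ∸ 1
injective-avoiding⇒≤ {n = ℕ.suc _} z f-inj z≢f =
  injective⇒≤ {f = λ i → punchOut (z≢f i)}
    (λ eq → f-inj (punchOut-injective (z≢f _) (z≢f _) eq))

remQuot-injective : ∀ {m} n → Injective _≡_ _≡_ (remQuot {m} n)
remQuot-injective {m} n {i} {j} eq = begin
  i                                 ≡⟨ combine-remQuot {m} n i ⟨
  uncurry combine (remQuot {m} n i) ≡⟨ cong (uncurry combine) eq ⟩
  uncurry combine (remQuot {m} n j) ≡⟨ combine-remQuot {m} n j ⟩
  j                                 ∎
  where open ≡-Reasoning

Unique⇒lookup-injective : ∀ {A : Set} {xs : List A} → Unique xs →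
  Injective _≡_ _≡_ (List.lookup xs)
Unique⇒lookup-injective (_ ∷ _)    {zero}  {zero}  _  = refl
Unique⇒lookup-injective (x∉xs ∷ _) {zero}  {suc j} eq =
  contradiction eq (All.lookup x∉xs (∈-lookup j))
Unique⇒lookup-injective (x∉xs ∷ _) {suc i} {zero}  eq =
  contradiction (sym eq) (All.lookup x∉xs (∈-lookup i))
Unique⇒lookup-injective (_ ∷ u)    {suc i} {suc j} eq =
  cong suc (Unique⇒lookup-injective u eq)

-- Indexing the members by `Fin ∣ A ∣` turns bounds on a cardinality into the construction of
-- injections.
enum : ∀ {n} (A : Subset n) → Fin ∣ A ∣ → Fin n
enum (inside  ∷ A) zero    = zero
enum (inside  ∷ A) (suc i) = suc (enum A i)
enum (outside ∷ A) i       = suc (enum A i)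

enum-∈ : ∀ {n} (A : Subset n) i → enum A i ∈ A
enum-∈ (inside  ∷ A) zero    = here
enum-∈ (inside  ∷ A) (suc i) = there (enum-∈ A i)
enum-∈ (outside ∷ A) i       = there (enum-∈ A i)

enum-injective : ∀ {n} (A : Subset n) → Injective _≡_ _≡_ (enum A)
enum-injective (inside  ∷ A) {zero}  {zero}  _  = refl
enum-injective (inside  ∷ A) {suc i} {suc j} eq =
  cong suc (enum-injective A (suc-injective eq))
enum-injective (outside ∷ A) eq = enum-injective A (suc-injective eq)

enum-surjective : ∀ {n} {A : Subset n} {x} → x ∈ A → ∃ λ i → enum A i ≡ x
enum-surjective {A = inside ∷ _} here = zero , refl
enum-surjective {A = inside ∷ _} (there x∈A) with i , eq ← enum-surjective x∈A =
  suc i , cong suc eq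
enum-surjective {A = outside ∷ _} (there x∈A) with i , eq ← enum-surjective x∈A =
  i , cong suc eq

does≡true⇒ : ∀ {A : Set} (a? : Dec A) → does a? ≡ true → A
does≡true⇒ {A} a? eq = invert (subst (Reflects A) eq (proof a?))

-- Signs are elements of `Fin 2` so that `remQuot` can split an index below `n * 2` into an object
-- and a sign.
±_ : Fin 2 → ℤ → ℤ
(± zero)     z = z
(± suc zero) z = - z

±-square : ∀ s z → (± s) z * (± s) z ≡ z * z
±-square zero       z = refl
±-square (suc zero) z = neg z
  where
  neg : ∀ z → (- z) * (- z) ≡ z * z
  neg = solve-∀

difference-of-squares : ∀ a b → a * a - b * b ≡ (a + b) * (a - b)
difference-of-squares = solve-∀

-- Congruence of integers modulo `p`.

module Congruence (p : ℕ) .{{_ : NonZero p}} where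

  infix 4 _≈_
  -- As plain divisibility of a difference, each closure property reduces to a ring identity.
  -- Endpoints are mostly passed explicitly because they cannot be recovered from the unfolded
  -- difference.
  _≈_ : ℤ → ℤ → Set
  a ≈ b = + p ℤ∣.∣ a - b

  ≈-sym : ∀ a b → a ≈ b → b ≈ a
  ≈-sym a b a≈b = subst (+ p ℤ∣.∣_) (identity a b) (∣m⇒∣-m a≈b)
    where
    identity : ∀ a b → - (a - b) ≡ b - a
    identity = solve-∀

  ≈-trans : ∀ a b c → a ≈ b → b ≈ c → a ≈ c
  ≈-trans a b c a≈b b≈c = subst (+ p ℤ∣.∣_) (identity a b c) (∣m∣n⇒∣m+n a≈b b≈c)
    where
    identity : ∀ a b c → (a - b) + (b - c) ≡ a - c
    identity = solve-∀

  ≈-minus : ∀ a b c d → a ≈ b → c ≈ d → a - c ≈ b - d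
  ≈-minus a b c d a≈b c≈d = subst (+ p ℤ∣.∣_) (identity a b c d) (∣m∣n⇒∣m-n a≈b c≈d)
    where
    identity : ∀ a b c d → (a - b) - (c - d) ≡ (a - c) - (b - d)
    identity = solve-∀

  ≈-square : ∀ a b → a ≈ b → a * a ≈ b * b
  ≈-square a b a≈b =
    subst (+ p ℤ∣.∣_) (trans (ℤ.*-comm (a - b) (a + b)) (sym (difference-of-squares a b)))
      (∣m⇒∣m*n (a + b) a≈b)

  ≈0⇒∣ : ∀ a → a ≈ 0ℤ → + p ℤ∣.∣ a
  ≈0⇒∣ a = subst (+ p ℤ∣.∣_) (ℤ.+-identityʳ a)

  ∣-of-≈ : ∀ a b → a ≈ b → + p ℤ∣.∣ a → + p ℤ∣.∣ b
  ∣-of-≈ a b a≈b p∣a = subst (+ p ℤ∣.∣_) (eq a b) (∣m∣n⇒∣m-n p∣a a≈b)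
    where
    eq : ∀ a b → a - (a - b) ≡ b
    eq = solve-∀

  ≈-%ℕ : ∀ z → z ≈ + (z %ℕ p)
  ≈-%ℕ z = divides (z /ℕ p)
    (trans (cong (_- + (z %ℕ p)) (a≡a%ℕn+[a/ℕn]*n z p)) (identity (+ (z %ℕ p)) _))
    where
    identity : ∀ a b → (a + b) - a ≡ b
    identity = solve-∀

  residue : ℤ → Fin p
  residue z = fromℕ< (n%ℕd<d z p)

  residue-≈ : ∀ z → z ≈ + toℕ (residue z)
  residue-≈ z = subst (λ r → z ≈ + r) (sym (toℕ-fromℕ< (n%ℕd<d z p))) (≈-%ℕ z)

  residue-≡⇒≈ : ∀ a b → residue a ≡ residue b → a ≈ b
  residue-≡⇒≈ a b eq = ≈-trans a _ b
    (subst (λ r → a ≈ + toℕ r) eq (residue-≈ a)) (≈-sym b _ (residue-≈ b))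

  -- The counting principle behind both upper bounds: reduction modulo `p` embeds the family into
  -- `Fin p` and misses the class of 0, which saves one.
  incongruent⇒≤ : ∀ {m} (f : Fin m → ℤ) → (∀ i → ¬ + p ℤ∣.∣ f i) →
    (∀ {i j} → f i ≈ f j → i ≡ j) → m ≤ p ∸ 1
  incongruent⇒≤ f p∤f f-inj = injective-avoiding⇒≤ (residue 0ℤ)
    (λ {i} {j} eq → f-inj (residue-≡⇒≈ (f i) (f j) eq))
    (λ i eq → p∤f i (≈0⇒∣ (f i) (residue-≡⇒≈ (f i) 0ℤ (sym eq))))

  -- The distance of two naturals is at most their maximum, hence below `p`, whereas a nonzero
  -- multiple of `p` has absolute value at least `p`.
  ≈⇒≡ : ∀ {m n} → m < p → n < p → + m ≈ + n → m ≡ n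
  ≈⇒≡ {m} {n} m<p n<p m≈n with ℤ.∣ + m - + n ∣ in eq
  ... | 0       = ℤ.+-injective (ℤ.i-j≡0⇒i≡j (+ m) (+ n) (ℤ.∣i∣≡0⇒i≡0 eq))
  ... | ℕ.suc k = contradiction p≤∣m-n∣ (ℕ.<⇒≱ ∣m-n∣<p)
    where
    p≤∣m-n∣ : p ≤ ℕ.suc k
    p≤∣m-n∣ = ℕ∣.∣⇒≤ (subst (p ℕ∣.∣_) eq (∣⇒∣ᵤ m≈n))

    ∣m-n∣<p : ℕ.suc k < p
    ∣m-n∣<p = ℕ.≤-<-trans
      (subst (_≤ m ℕ.⊔ n) (trans (cong ℤ.∣_∣ (sym (ℤ.m-n≡m⊖n m n))) eq)
        (ℤ.∣m⊝n∣≤m⊔n m n))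
      (ℕ.⊔-lub m<p n<p)

  Fin-≈⇒≡ : ∀ {x y : Fin p} → + toℕ x ≈ + toℕ y → x ≡ y
  Fin-≈⇒≡ {x} {y} = toℕ-injective ∘ ≈⇒≡ (toℕ<n x) (toℕ<n y)

  pos-^2 : ∀ n → + (n ^ 2) ≡ + n * + n
  pos-^2 n = trans (cong (λ k → + (n ℕ.* k)) (ℕ.*-identityʳ n)) (ℤ.pos-* n n)

  mod-≈ : ∀ n → + n ≈ + toℕ (n mod p)
  -- For a nonnegative integer `_%ℕ_` computes to the remainder used by `_mod_`.
  mod-≈ n = residue-≈ (+ n)

  -- Roots of nonzero squares.

  root : ∀ {y} → IsNonzeroSquare p y → ℤ
  root (x , _) = + toℕ x

  p∤root : ∀ {y} (q : IsNonzeroSquare p y) → ¬ + p ℤ∣.∣ root q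
  p∤root (_ , p∤x , _) = p∤x ∘ ∣⇒∣ᵤ

  root-square : ∀ {y} (q : IsNonzeroSquare p y) → root q * root q ≈ + toℕ y
  root-square (x , _ , refl) =
    subst (_≈ + toℕ ((toℕ x ^ 2) mod p)) (pos-^2 (toℕ x)) (mod-≈ (toℕ x ^ 2))

  ∈𝒬⇒square : ∀ {y} → y ∈ 𝒬 p → IsNonzeroSquare p y
  ∈𝒬⇒square {y} y∈𝒬 = does≡true⇒ (isNonzeroSquare? p y)
    (trans (sym (lookup∘tabulate _ y)) ([]=⇒lookup y∈𝒬))

  square⇒∈𝒬 : ∀ {y} → IsNonzeroSquare p y → y ∈ 𝒬 p
  square⇒∈𝒬 {y} q = lookup⇒[]= y (𝒬 p)
    (trans (lookup∘tabulate _ y) (dec-true (isNonzeroSquare? p y) q))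

  -- Squaring removes the signs, and the squared roots are congruent to `y` and `y′`, both already
  -- reduced.
  ±root-≈⇒≡ : ∀ {y y′} (q : IsNonzeroSquare p y) (q′ : IsNonzeroSquare p y′) s s′ →
    (± s) (root q) ≈ (± s′) (root q′) → y ≡ y′
  ±root-≈⇒≡ {y} {y′} q q′ s s′ eq = Fin-≈⇒≡
    (≈-trans (+ toℕ y) x² (+ toℕ y′) (≈-sym x² (+ toℕ y) (root-square q))
      (≈-trans x² x′² (+ toℕ y′)
        (subst₂ _≈_ (±-square s (root q)) (±-square s′ (root q′))
          (≈-square ((± s) (root q)) ((± s′) (root q′)) eq))
        (root-square q′)))
    where
    x² x′² : ℤ
    x²  = root q * root q
    x′² = root q′ * root q′

  -- Cancellation modulo an odd prime.

  module OddPrime (p-prime : Prime p) (2<p : 2 < p) where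

    ∣*⇒∣⊎∣ : ∀ a b → + p ℤ∣.∣ a * b → + p ℤ∣.∣ a ⊎ + p ℤ∣.∣ b
    ∣*⇒∣⊎∣ a b p∣ab
      with euclidsLemma ℤ.∣ a ∣ ℤ.∣ b ∣ p-prime (subst (p ℕ∣.∣_) (ℤ.abs-* a b) (∣⇒∣ᵤ p∣ab))
    ... | inj₁ p∣a = inj₁ (∣ᵤ⇒∣ p∣a)
    ... | inj₂ p∣b = inj₂ (∣ᵤ⇒∣ p∣b)

    -- Halving is legitimate because `p` exceeds 2 and so cannot divide it.
    ∣2*⇒∣ : ∀ a → + p ℤ∣.∣ + 2 * a → + p ℤ∣.∣ a
    ∣2*⇒∣ a p∣2a with ∣*⇒∣⊎∣ (+ 2) a p∣2a
    ... | inj₁ p∣2 = contradiction (∣⇒∣ᵤ p∣2) (ℕ∣.>⇒∤ 2<p)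
    ... | inj₂ p∣a = p∣a

    -- Opposite signs would give `p` dividing `2 * z`, hence `z`.
    ±-≈⇒≡ : ∀ s s′ z → ¬ + p ℤ∣.∣ z → (± s) z ≈ (± s′) z → s ≡ s′
    ±-≈⇒≡ zero       zero       z _   _  = refl
    ±-≈⇒≡ zero       (suc zero) z p∤z eq =
      contradiction (∣2*⇒∣ z (subst (+ p ℤ∣.∣_) (identity z) eq)) p∤z
      where
      identity : ∀ z → z - (- z) ≡ + 2 * z
      identity = solve-∀
    ±-≈⇒≡ (suc zero) zero       z p∤z eq =
      contradiction (∣2*⇒∣ z (subst (+ p ℤ∣.∣_) (identity z) (∣m⇒∣-m eq))) p∤z
      where
      identity : ∀ z → - (- z - z) ≡ + 2 * z
      identity = solve-∀
    ±-≈⇒≡ (suc zero) (suc zero) z _   _  = refl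

    -- This is division of `r` by `s`: were `p` to divide `s`, it would divide `r`, so `s` can be
    -- cancelled from `s * (d - d′)`.
    product-determines : ∀ s d s′ d′ r → ¬ + p ℤ∣.∣ r →
      s * d ≈ r → s′ * d′ ≈ r → s ≈ s′ → d ≈ d′
    product-determines s d s′ d′ r p∤r sd≈r s′d′≈r s≈s′ =
      [ (λ p∣s → contradiction (∣-of-≈ (s * d) r sd≈r (∣m⇒∣m*n d p∣s)) p∤r) , id ]′
        (∣*⇒∣⊎∣ s (d - d′) (subst (+ p ℤ∣.∣_) (eq s d s′ d′ r)
          (∣m∣n⇒∣m-n (∣m∣n⇒∣m-n sd≈r s′d′≈r) (∣m⇒∣m*n d′ s≈s′))))
      where
      eq : ∀ s d s′ d′ r →
        (s * d - r) - (s′ * d′ - r) - (s - s′) * d′ ≡ s * (d - d′)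
      eq = solve-∀

    -- Adding and subtracting the two congruences gives twice each unknown.
    sum∧difference-determine : ∀ x y x′ y′ →
      x + y ≈ x′ + y′ → x - y ≈ x′ - y′ → x ≈ x′ × y ≈ y′
    sum∧difference-determine x y x′ y′ sum difference =
      ∣2*⇒∣ (x - x′) (subst (+ p ℤ∣.∣_) (eq₁ x y x′ y′) (∣m∣n⇒∣m+n sum difference)) ,
      ∣2*⇒∣ (y - y′) (subst (+ p ℤ∣.∣_) (eq₂ x y x′ y′) (∣m∣n⇒∣m-n sum difference))
      where
      eq₁ : ∀ x y x′ y′ →
        ((x + y) - (x′ + y′)) + ((x - y) - (x′ - y′)) ≡ + 2 * (x - x′)
      eq₁ = solve-∀
      eq₂ : ∀ x y x′ y′ →
        ((x + y) - (x′ + y′)) - ((x - y) - (x′ - y′)) ≡ + 2 * (y - y′)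
      eq₂ = solve-∀

    -- Representations of a nonzero residue as a difference of squares.

    module _ (r : Fin p) (r≢0 : toℕ r ≢ 0) where

      p∤r : ¬ + p ℤ∣.∣ + toℕ r
      p∤r p∣r = r≢0 (≈⇒≡ (toℕ<n r) (ℕ.<-trans (ℕ.s≤s ℕ.z≤n) 2<p)
        (subst (+ p ℤ∣.∣_) (sym (ℤ.+-identityʳ (+ toℕ r))) p∣r))

      representations : List (Fin p × Fin p)
      representations =
        filter (hasDifference? p (𝒬 p) r) (cartesianProduct (allFin p) (allFin p))

      representations-unique : Unique representations
      representations-unique = filter⁺ (hasDifference? p (𝒬 p) r)
        (cartesianProduct⁺ (allFin⁺ p) (allFin⁺ p))

      hasDifference : ∀ i → HasDifference p (𝒬 p) r (List.lookup representations i)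
      hasDifference i = All.lookup
        (all-filter (hasDifference? p (𝒬 p) r) (cartesianProduct (allFin p) (allFin p)))
        (∈-lookup i)

      q₁ : ∀ i → IsNonzeroSquare p (proj₁ (List.lookup representations i))
      q₁ i = ∈𝒬⇒square (proj₁ (hasDifference i))

      q₂ : ∀ i → IsNonzeroSquare p (proj₂ (List.lookup representations i))
      q₂ i = ∈𝒬⇒square (proj₁ (proj₂ (hasDifference i)))

      x y : Fin (length representations) → Fin 2 → ℤ
      x i s = (± s) (root (q₁ i))
      y i t = (± t) (root (q₂ i))

      difference-≈ : ∀ i →
        let a , a′ = List.lookup representations i in + toℕ a - + toℕ a′ ≈ + toℕ r
      difference-≈ i
        with a , a′ ← List.lookup representations i
           | _ , _ , _ , eq ← hasDifference i
        = subst₂ (λ z k → z ≈ + k) (sym (ℤ.m-n≡m⊖n (toℕ a) (toℕ a′))) eq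
            (≈-%ℕ (toℕ a ℤ.⊖ toℕ a′))

      -- The product is a difference of squares, in which the signs vanish; all four choices of `s`
      -- and `t` therefore give the same residue.
      [x+y]*[x-y]≈r : ∀ i s t → (x i s + y i t) * (x i s - y i t) ≈ + toℕ r
      [x+y]*[x-y]≈r i s t = subst (_≈ + toℕ r)
        (trans
          (sym (cong₂ _-_ (±-square s (root (q₁ i))) (±-square t (root (q₂ i)))))
          (difference-of-squares (x i s) (y i t)))
        (≈-trans (root (q₁ i) * root (q₁ i) - root (q₂ i) * root (q₂ i)) _ (+ toℕ r)
          (≈-minus (root (q₁ i) * root (q₁ i)) (+ toℕ a)
                   (root (q₂ i) * root (q₂ i)) (+ toℕ a′)
                   (root-square (q₁ i)) (root-square (q₂ i)))
          (difference-≈ i))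
        where
        a  = proj₁ (List.lookup representations i)
        a′ = proj₂ (List.lookup representations i)

      signedSum : Fin (length representations) × Fin 2 × Fin 2 → ℤ
      signedSum (i , s , t) = x i s + y i t

      -- A sum divisible by `p` would make the whole product, hence `r`, divisible by `p`.
      p∤signedSum : ∀ k → ¬ + p ℤ∣.∣ signedSum k
      p∤signedSum (i , s , t) p∣x+y = p∤r
        (∣-of-≈ ((x i s + y i t) * (x i s - y i t)) (+ toℕ r) ([x+y]*[x-y]≈r i s t)
          (∣m⇒∣m*n (x i s - y i t) p∣x+y))

      -- Equal sums with the common product `r` force equal differences, and sum and difference fix
      -- both terms.
      signedSum-determines : ∀ i s t i′ s′ t′ → x i s + y i t ≈ x i′ s′ + y i′ t′ →
        x i s ≈ x i′ s′ × y i t ≈ y i′ t′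
      signedSum-determines i s t i′ s′ t′ eq =
        sum∧difference-determine (x i s) (y i t) (x i′ s′) (y i′ t′) eq
          (product-determines (x i s + y i t) (x i s - y i t)
            (x i′ s′ + y i′ t′) (x i′ s′ - y i′ t′) (+ toℕ r) p∤r
            ([x+y]*[x-y]≈r i s t) ([x+y]*[x-y]≈r i′ s′ t′) eq)

      -- Signed roots determine the pair of marks, and the list of representations has no
      -- repetitions.
      index-unique : ∀ i s t i′ s′ t′ → x i s ≈ x i′ s′ → y i t ≈ y i′ t′ → i ≡ i′
      index-unique i s t i′ s′ t′ x≈x′ y≈y′ =
        Unique⇒lookup-injective representations-unique
          (cong₂ _,_ (±root-≈⇒≡ (q₁ i) (q₁ i′) s s′ x≈x′)
                     (±root-≈⇒≡ (q₂ i) (q₂ i′) t t′ y≈y′))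

      signs-unique : ∀ {i i′} s t s′ t′ → i ≡ i′ →
        x i s ≈ x i′ s′ → y i t ≈ y i′ t′ → (i , s , t) ≡ (i′ , s′ , t′)
      -- Once the indices are identified, both sides use the same chosen roots, so only the signs
      -- remain to be compared.
      signs-unique {i} s t s′ t′ refl x≈x′ y≈y′ = cong₂ (λ s t → i , s , t)
        (±-≈⇒≡ s s′ (root (q₁ i)) (p∤root (q₁ i)) x≈x′)
        (±-≈⇒≡ t t′ (root (q₂ i)) (p∤root (q₂ i)) y≈y′)

      signedSum-injective : ∀ k l → signedSum k ≈ signedSum l → k ≡ l
      signedSum-injective (i , s , t) (i′ , s′ , t′) eq =
        let x≈x′ , y≈y′ = signedSum-determines i s t i′ s′ t′ eq in
        signs-unique s t s′ t′ (index-unique i s t i′ s′ t′ x≈x′ y≈y′) x≈x′ y≈y′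

      -- The two factors 2 carry the signs of the two roots.
      decode : Fin (length representations ℕ.* 2 ℕ.* 2) →
        Fin (length representations) × Fin 2 × Fin 2
      decode = assocʳ′ ∘ map₁ (remQuot 2) ∘ remQuot 2

      decode-injective : Injective _≡_ _≡_ decode
      decode-injective eq = remQuot-injective 2
        (cong₂ _,_ (remQuot-injective 2 (cong (proj₁ ∘ assocˡ′) eq))
                   (cong (proj₂ ∘ assocˡ′) eq))

      occurrences*2*2≤ : occurrences p (𝒬 p) r ℕ.* 2 ℕ.* 2 ≤ p ∸ 1
      -- By definition `occurrences p (𝒬 p) r` is `length representations`.
      occurrences*2*2≤ = incongruent⇒≤ (signedSum ∘ decode) (p∤signedSum ∘ decode)
        (λ {k} {l} → decode-injective ∘ signedSum-injective (decode k) (decode l))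

    -- The number of nonzero squares.

    element : ∀ i → IsNonzeroSquare p (enum (𝒬 p) i)
    element i = ∈𝒬⇒square (enum-∈ (𝒬 p) i)

    signedRoot : Fin ∣ 𝒬 p ∣ × Fin 2 → ℤ
    signedRoot (i , s) = (± s) (root (element i))

    p∤signedRoot : ∀ k → ¬ + p ℤ∣.∣ signedRoot k
    p∤signedRoot (i , s) = p∤root (element i) ∘ ∣±⇒∣ s
      where
      ∣±⇒∣ : ∀ s {z} → + p ℤ∣.∣ (± s) z → + p ℤ∣.∣ z
      ∣±⇒∣ zero           p∣z  = p∣z
      ∣±⇒∣ (suc zero) {z} p∣-z = subst (+ p ℤ∣.∣_) (ℤ.neg-involutive z) (∣m⇒∣-m p∣-z)

    sign-unique : ∀ {i i′} s s′ → i ≡ i′ → signedRoot (i , s) ≈ signedRoot (i′ , s′) →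
      (i , s) ≡ (i′ , s′)
    sign-unique {i} s s′ refl eq =
      cong (i ,_) (±-≈⇒≡ s s′ (root (element i)) (p∤root (element i)) eq)

    signedRoot-injective : ∀ k l → signedRoot k ≈ signedRoot l → k ≡ l
    signedRoot-injective (i , s) (i′ , s′) eq = sign-unique s s′
      (enum-injective (𝒬 p) (±root-≈⇒≡ (element i) (element i′) s s′ eq)) eq

    -- Each square contributes two incongruent nonzero roots, and distinct squares share none.
    ∣𝒬∣*2≤ : ∣ 𝒬 p ∣ ℕ.* 2 ≤ p ∸ 1
    ∣𝒬∣*2≤ = incongruent⇒≤ (signedRoot ∘ remQuot 2) (p∤signedRoot ∘ remQuot 2)
      (λ {k} {l} → remQuot-injective 2 ∘
        signedRoot-injective (remQuot 2 k) (remQuot 2 l))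

    half : ℕ
    half = (p ∸ 1) / 2

    -- Needed to exclude that `p` divides the sum of two bases when their squares agree.
    small+small<p : ∀ (i j : Fin half) → ℕ.suc (toℕ i) ℕ.+ ℕ.suc (toℕ j) < p
    small+small<p i j = begin-strict
      ℕ.suc (toℕ i) ℕ.+ ℕ.suc (toℕ j) ≤⟨ ℕ.+-mono-≤ (toℕ<n i) (toℕ<n j) ⟩
      -- `2 ℕ.* half` computes to `half ℕ.+ (half ℕ.+ 0)`.
      half ℕ.+ half                   ≡⟨ cong (half ℕ.+_) (ℕ.+-identityʳ half) ⟨
      2 ℕ.* half                      ≡⟨ ℕ.*-comm 2 half ⟩
      half ℕ.* 2                      ≤⟨ m/n*n≤m (p ∸ 1) 2 ⟩
      p ∸ 1                           <⟨ ℕ.∸-monoʳ-< (ℕ.s≤s ℕ.z≤n) (ℕ.>-nonZero⁻¹ p) ⟩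
      p                               ∎
      where open ℕ.≤-Reasoning

    small<p : ∀ (i : Fin half) → ℕ.suc (toℕ i) < p
    small<p i = ℕ.≤-<-trans (ℕ.m≤m+n _ _) (small+small<p i i)

    -- The successor shifts the bases to 1, ..., `half`, leaving out 0.
    smallSquare : Fin half → Fin p
    smallSquare i = (ℕ.suc (toℕ i) ^ 2) mod p

    smallSquare-∈ : ∀ i → smallSquare i ∈ 𝒬 p
    smallSquare-∈ i = square⇒∈𝒬 (fromℕ< (small<p i) ,
      subst (p ∤_) (sym toℕ-x) (ℕ∣.>⇒∤ (small<p i)) ,
      cong (λ n → (n ^ 2) mod p) toℕ-x)
      where
      toℕ-x : toℕ (fromℕ< (small<p i)) ≡ ℕ.suc (toℕ i)
      toℕ-x = toℕ-fromℕ< (small<p i)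

    -- By Euclid's lemma `p` divides `m + n` or `m - n`. The sum is positive and below `p`, so the
    -- difference remains, and both bases are below `p`.
    smallSquare-injective : Injective _≡_ _≡_ smallSquare
    smallSquare-injective {i} {j} eq =
      [ (λ p∣m+n → contradiction (∣⇒∣ᵤ p∣m+n) (ℕ∣.>⇒∤ (small+small<p i j)))
      , toℕ-injective ∘ ℕ.suc-injective ∘ ≈⇒≡ (small<p i) (small<p j)
      ]′ (∣*⇒∣⊎∣ (+ m + + n) (+ m - + n)
        (subst (+ p ℤ∣.∣_) (difference-of-squares (+ m) (+ n))
          (subst₂ _≈_ (pos-^2 m) (pos-^2 n) (residue-≡⇒≈ (+ (m ^ 2)) (+ (n ^ 2)) eq))))
      where
      m n : ℕ
      m = ℕ.suc (toℕ i)
      n = ℕ.suc (toℕ j)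

    -- Sending each small base to the position of its square in the enumeration of `𝒬 p` is
    -- injective.
    half≤∣𝒬∣ : half ≤ ∣ 𝒬 p ∣
    half≤∣𝒬∣ = injective⇒≤ {f = λ i → proj₁ (index i)} λ {i} {j} eq →
      smallSquare-injective
        (trans (sym (proj₂ (index i))) (trans (cong (enum (𝒬 p)) eq) (proj₂ (index j))))
      where
      index : ∀ i → ∃ λ k → enum (𝒬 p) k ≡ smallSquare i
      index i = enum-surjective (smallSquare-∈ i)

-- Passage to floors and conclusion.

m*n≤o⇒m≤o/n : ∀ m n {o} .{{_ : NonZero n}} → m ℕ.* n ≤ o → m ≤ o / n
m*n≤o⇒m≤o/n m n m*n≤o = subst (_≤ _) (m*n/n≡m m n) (/-monoˡ-≤ n m*n≤o)

theorem10 : ∀ (p : ℕ) .{{_ : NonZero p}} → Prime p → 5 ≤ p → 2 ∤ p →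
    IsModularGolombRuler p g[ p ] (𝒬 p) × ∣ 𝒬 p ∣ ≡ (p ∸ 1) / 2
theorem10 p p-prime 5≤p _ =
  -- The factor 4 arrives as two factors 2; dividing twice with floor agrees with dividing once by
  -- 4.
  (λ r r≢0 → subst (occurrences p (𝒬 p) r ≤_) (m/n/o≡m/[n*o] (p ∸ 1) 2 2)
    (m*n≤o⇒m≤o/n _ 2 (m*n≤o⇒m≤o/n _ 2 (occurrences*2*2≤ r r≢0)))) ,
  ℕ.≤-antisym (m*n≤o⇒m≤o/n _ 2 ∣𝒬∣*2≤) half≤∣𝒬∣
  where
  open Congruence p
  open OddPrime p-prime (ℕ.<-≤-trans (ℕ.s≤s (ℕ.s≤s (ℕ.s≤s ℕ.z≤n))) 5≤p)
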